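{- Let $F\in\mathcal{T}^N_3$ satisfy $P^N(F)=\sup_{E\in\mathcal{T}^N_3}P^N(E)$, and suppose that the associated sequence of $F$ is $(1,n_2,n_3,n_4,1)$ with $n_3>1$. Then $\max\{n_2,n_4\}\le 2$.
   Context: A trunk graph with $N>0$ edges is a directed graph with vertices $v_1,\dots,v_n$ ($n\ge2$) such that every edge goes from some $v_i$ to $v_{i+1}$, there are $m_i\ge1$ edges from $v_i$ to $v_{i+1}$ for each $1\le i\le n-1$, and $m_1+\dots+m_{n-1}=N$. $\mathcal{T}^N_3$ is the set of trunk graphs with $N$ edges and all $m_i\le3$. $P^N(E)$ is the number of all finite directed paths in $E$, where vertices count as paths of length $0$. A trunk graph has associated sequence $(n_1,n_2,n_3,n_4,n_5)$ (with $n_j\ge0$) if $(m_1,\dots,m_{n-1})$ consists of $n_1$ ones, followed by $n_2$ twos, then $n_3$ threes, then $n_4$ twos, then $n_5$ ones. -}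

module Defs where

open import Axiom.UniquenessOfIdentityProofs using (module Decidable⇒UIP)
open import Data.Empty using (⊥; ⊥-elim)
open import Data.Fin.Base using (Fin; zero; suc; toℕ; inject₁; fromℕ)
open import Data.Fin.Induction using (>-weakInduction)
open import Data.Fin.Properties
  using (1↔⊤; +↔⊎; *↔×; toℕ-injective; toℕ-inject₁; toℕ-fromℕ; toℕ<n; _≟_)
open import Data.List.Base as List using (_++_)
open import Data.Nat.Base using (ℕ; suc; _+_; _*_; _≤_)
open import Data.Nat.Properties using (<-irrefl)
open import Data.Product using (Σ; ∃; ∃₂; _×_; _,_; proj₁; proj₂)
open import Data.Product.Function.NonDependent.Propositional using (_×-↔_)
open import Data.Sum.Base using (_⊎_; inj₁; inj₂)
open import Data.Sum.Function.Propositional using (_⊎-↔_)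
open import Data.Unit.Base using (⊤; tt)
open import Data.Vec.Base using (Vec; lookup; sum; toList)
open import Data.Vec.Relation.Unary.All using (All)
open import Function.Bundles using (_↔_; mk↔ₛ′)
open import Function.Construct.Composition using (_↔-∘_)
open import Relation.Binary.Construct.Closure.ReflexiveTransitive using (Star; ε; _◅_)
open import Relation.Binary.PropositionalEquality
  using (_≡_; refl; trans; cong)

-- The vertices are indexed from 0, so that  Fin (2 + k)  is v₁ , … , vₙ with
-- n = 2 + k, and  lookup mult i  is the number of edges from  inject₁ i  to
-- suc i.  A type  Edge u v  may have several elements (parallel edges).
record TrunkGraph (N : ℕ) : Set₁ where
  field
    k           : ℕ
    Edge        : Fin (2 + k) → Fin (2 + k) → Set
    consecutive : ∀ {u v} → Edge u v → toℕ v ≡ suc (toℕ u)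
    mult        : Vec ℕ (suc k)
    edges       : ∀ i → Fin (lookup mult i) ↔ Edge (inject₁ i) (suc i)
    mult≥1      : All (1 ≤_) mult
    total       : sum mult ≡ N

  Vertex : Set
  Vertex = Fin (2 + k)

  -- Star Edge u v  is the type of directed paths from u to v; its constructor
  -- ε  is the path of length 0.
  Path : Set
  Path = ∃₂ λ u v → Star Edge u v

open TrunkGraph

InT₃ : ∀ {N} → TrunkGraph N → Set
InT₃ E = All (_≤ 3) (mult E)

HasSequence : ∀ {N} → TrunkGraph N → (n₁ n₂ n₃ n₄ n₅ : ℕ) → Set
HasSequence E n₁ n₂ n₃ n₄ n₅ =
  toList (mult E) ≡
    List.replicate n₁ 1 ++ List.replicate n₂ 2 ++ List.replicate n₃ 3 ++
    List.replicate n₄ 2 ++ List.replicate n₅ 1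

Finite : Set → Set
Finite A = ∃ λ c → Fin c ↔ A

finite-↔ : ∀ {A B} → A ↔ B → Finite A → Finite B
finite-↔ A↔B (c , f) = c , (A↔B ↔-∘ f)

finite-⊤ : Finite ⊤
finite-⊤ = 1 , 1↔⊤

finite-⊎ : ∀ {A B} → Finite A → Finite B → Finite (A ⊎ B)
finite-⊎ (a , f) (b , g) = a + b , ((f ⊎-↔ g) ↔-∘ +↔⊎)

finite-× : ∀ {A B} → Finite A → Finite B → Finite (A × B)
finite-× (a , f) (b , g) = a * b , ((f ×-↔ g) ↔-∘ *↔×)

finite-Σ : ∀ {n} {B : Fin n → Set} → (∀ i → Finite (B i)) → Finite (Σ (Fin n) B)
finite-Σ {0}     {B} f =
  0 , mk↔ₛ′ (λ ()) (λ { (() , _) }) (λ { (() , _) }) (λ ())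
finite-Σ {suc n} {B} f = finite-↔ split (finite-⊎ (f zero) (finite-Σ (λ i → f (suc i))))
  where
  split : (B zero ⊎ Σ (Fin n) (λ i → B (suc i))) ↔ Σ (Fin (suc n)) B
  split = mk↔ₛ′
    (λ { (inj₁ b) → zero , b ; (inj₂ (i , b)) → suc i , b })
    (λ { (zero , b) → inj₁ b ; (suc i , b) → inj₂ (i , b) })
    (λ { (zero , b) → refl ; (suc i , b) → refl })
    (λ { (inj₁ b) → refl ; (inj₂ (i , b)) → refl })

module _ {N : ℕ} (E : TrunkGraph N) where

  PathFrom : Vertex E → Set
  PathFrom u = ∃ λ v → Star (Edge E) u v

  NonTrivialFrom : Vertex E → Set
  NonTrivialFrom u = ∃ λ v → Edge E u v × PathFrom v

  unfold : ∀ u → (⊤ ⊎ NonTrivialFrom u) ↔ PathFrom u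
  unfold u = mk↔ₛ′
    (λ { (inj₁ tt) → u , ε ; (inj₂ (v , e , w , p)) → w , e ◅ p })
    (λ { (_ , ε) → inj₁ tt ; (w , e ◅ p) → inj₂ (_ , e , w , p) })
    (λ { (_ , ε) → refl ; (w , e ◅ p) → refl })
    (λ { (inj₁ tt) → refl ; (inj₂ (v , e , w , p)) → refl })

  last-none : ∀ {v} → Edge E (fromℕ (suc (k E))) v → ⊥
  last-none {v} e = <-irrefl eq (toℕ<n v)
    where
    eq : toℕ v ≡ 2 + k E
    eq = trans (consecutive E e) (cong suc (toℕ-fromℕ (suc (k E))))

  next≡ : ∀ i {v} → Edge E (inject₁ i) v → v ≡ suc i
  next≡ i e = toℕ-injective (trans (consecutive E e) (cong suc (toℕ-inject₁ i)))

  step : ∀ i → (Edge E (inject₁ i) (suc i) × PathFrom (suc i)) ↔ NonTrivialFrom (inject₁ i)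
  step i = mk↔ₛ′ (λ x → suc i , x) (λ (v , e , p) → from (next≡ i e) e p)
                 (λ (v , e , p) → to∘from (next≡ i e) e p)
                 (λ (e , p) → from∘to (next≡ i e) e p)
    where
    from : ∀ {v} → v ≡ suc i → Edge E (inject₁ i) v → PathFrom v →
           Edge E (inject₁ i) (suc i) × PathFrom (suc i)
    from refl e p = e , p
    to∘from : ∀ {v} (eq : v ≡ suc i) e p → (suc i , from eq e p) ≡ (v , e , p)
    to∘from refl e p = refl
    from∘to : ∀ (eq : suc i ≡ suc i) e p → from eq e p ≡ (e , p)
    from∘to eq e p rewrite Decidable⇒UIP.≡-irrelevant _≟_ eq refl = refl

  pathFrom-finite : ∀ u → Finite (PathFrom u)
  pathFrom-finite = >-weakInduction (λ u → Finite (PathFrom u)) base ind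
    where
    base : Finite (PathFrom (fromℕ (suc (k E))))
    base = finite-↔ (unfold _) (finite-⊎ finite-⊤
      (0 , mk↔ₛ′ (λ ()) (λ (_ , e , _) → ⊥-elim (last-none e))
                 (λ (_ , e , _) → ⊥-elim (last-none e)) (λ ())))
    ind : ∀ i → Finite (PathFrom (suc i)) → Finite (PathFrom (inject₁ i))
    ind i fin = finite-↔ (unfold _) (finite-⊎ finite-⊤
      (finite-↔ (step i) (finite-× (_ , edges E i) fin)))

  path-finite : Finite (Path E)
  path-finite = finite-Σ pathFrom-finite

  P : ℕ
  P = proj₁ path-finite

IsSupremum : (ℕ → Set₁) → ℕ → Set₁
IsSupremum S s = (∀ x → S x → x ≤ s) × (∀ b → (∀ x → S x → x ≤ b) → s ≤ b)

PathCounts : ℕ → ℕ → Set₁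
PathCounts N x = Σ (TrunkGraph N) λ E → InT₃ E × x ≡ P E

{-# OPTIONS --safe #-}
module Submission where

-- Only the word of multiplicities matters.  If R is the number of paths that
-- start at the first vertex of the trunk graph with word ms, then m ∷ ms has
-- 1 + m * R paths starting at its own first vertex.  So the total number of
-- paths is computed by a recursion on the word (pathCount, P≡pathCount), and
-- every non-empty word with letters in 1 , 2 , 3 belongs to a trunk graph
-- (trunk).  Moreover pathCount is invariant under reversal
-- (pathCount-reverse), because paths may equally be counted by their ends.
--
-- It remains to show that a word  1 2ᵃ 3ᵇ 2ᶜ 1  with a ≥ 3 and b ≥ 2 does not
-- have the most paths among the words with the same sum; the case c ≥ 3
-- follows by reversal.
--
-- * Replace three consecutive 2s by two 3s.  If l paths end at the left of the
--   block and r paths start at its right, the gain is (l - 3) * (r - 3) - 12.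
--   If a ≥ 4, take the last three 2s of the first run: then l ≥ 5 and r ≥ 10,
--   so the gain is positive (exchange, improve-long).
--
-- * By reversal this settles c ≥ 4 as well.  There remain a = 3 and c ≤ 3,
--   where the exchange loses because l = 2 (improve-short).  If c ≤ 1, moving
--   one 2 from the left of the 3s to their right helps.  If c is 2 or 3,
--   replacing two 2s on the left and one on the right by two 3s helps.  The
--   path counts before and after are explicit functions of b
--   (pathCount-word), and their difference is affine in 3ᵇ and positive.

open import Defs
open import Axiom.UniquenessOfIdentityProofs using (module Decidable⇒UIP)
open import Data.Empty using (⊥; ⊥-elim)
open import Data.Fin.Base using (Fin; zero; suc; toℕ; inject₁; fromℕ)
open import Data.Fin.Permutation using (↔⇒≡)
open import Data.Fin.Properties using (toℕ-inject₁)
  renaming (_≟_ to _≟ᶠ_)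
open import Data.List.Base as List
  using (List; []; _∷_; [_]; _++_; _∷ʳ_; replicate; reverse; foldl)
open import Data.List.Properties
  using (unfold-reverse; reverse-++; reverse-foldl; ++-assoc)
open import Data.List.Relation.Unary.All using (All; _∷_; [])
open import Data.List.Relation.Unary.All.Properties using (++⁺; replicate⁺)
open import Data.Nat using (ℕ; zero; suc; _+_; _*_; _<_; _≤_; _⊔_; z≤n; s≤s)
open import Data.Nat.ListAction using (sum)
open import Data.Nat.Properties
open import Data.Nat.Tactic.RingSolver using (solve-∀)
open import Data.Product using (∃; _×_; _,_; proj₁; proj₂)
open import Data.Sum.Base using (inj₁; inj₂)
open import Data.Vec.Base as Vec using (Vec; lookup; toList; fromList)
open import Data.Vec.Properties using (toList∘fromList)
import Data.Vec.Relation.Unary.All.Properties as VecAll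
open import Function.Bundles using (mk↔ₛ′)
open import Function.Construct.Composition using (_↔-∘_)
open import Function.Construct.Symmetry using (↔-sym)
open import Relation.Binary.PropositionalEquality
  using (_≡_; refl; sym; trans; cong; cong₂; subst; subst₂; module ≡-Reasoning)
open import Relation.Nullary using (¬_)

-- Counting paths from the word of multiplicities

-- The number of paths that start at the first vertex of the trunk graph whose
-- word of multiplicities is the given list.  The empty word stands for the
-- graph with a single vertex.
departures : List ℕ → ℕ
departures []       = 1
departures (m ∷ ms) = 1 + m * departures ms

pathCount : List ℕ → ℕ
pathCount []       = 1
pathCount (m ∷ ms) = departures (m ∷ ms) + pathCount ms

-- The number of paths that end at the last vertex, if l paths end at the first
-- one.
arrivals : ℕ → List ℕ → ℕ
arrivals = foldl (λ l m → 1 + m * l)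

-- The number of paths counted by their end vertices, if l paths (coming from
-- further left) end at the first vertex.
sweep : ℕ → List ℕ → ℕ
sweep l []       = l
sweep l (m ∷ ms) = l + sweep (1 + m * l) ms

sweep-suc : ∀ x ms → sweep (1 + x) ms ≡ pathCount ms + x * departures ms
sweep-suc x []       = cong suc (sym (*-identityʳ x))
sweep-suc x (m ∷ ms) = trans
  (cong (suc x +_) (sweep-suc (m * suc x) ms))
  (regroup x m (departures ms) (pathCount ms))
  where
  regroup : ∀ x m r p →
    1 + x + (p + m * (1 + x) * r) ≡ (1 + m * r) + p + x * (1 + m * r)
  regroup = solve-∀

pathCount≡sweep : ∀ ms → pathCount ms ≡ sweep 1 ms
pathCount≡sweep ms = sym (trans (sweep-suc 0 ms) (+-identityʳ _))

sweep-∷ʳ : ∀ l ms m → sweep l (ms ∷ʳ m) ≡ sweep l ms + (1 + m * arrivals l ms)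
sweep-∷ʳ l []       m = refl
sweep-∷ʳ l (k ∷ ms) m =
  trans (cong (l +_) (sweep-∷ʳ (1 + k * l) ms m)) (sym (+-assoc l _ _))

arrivals-reverse : ∀ ms → arrivals 1 (reverse ms) ≡ departures ms
arrivals-reverse ms = trans (reverse-foldl _ 1 ms) (foldr≡departures ms)
  where
  foldr≡departures : ∀ ms → List.foldr (λ m l → 1 + m * l) 1 ms ≡ departures ms
  foldr≡departures []       = refl
  foldr≡departures (m ∷ ms) = cong (λ r → 1 + m * r) (foldr≡departures ms)

pathCount-reverse : ∀ ms → pathCount (reverse ms) ≡ pathCount ms
pathCount-reverse []       = refl
pathCount-reverse (m ∷ ms) = begin
  pathCount (reverse (m ∷ ms))
    ≡⟨ cong pathCount (unfold-reverse m ms) ⟩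
  pathCount (reverse ms ∷ʳ m)
    ≡⟨ pathCount≡sweep (reverse ms ∷ʳ m) ⟩
  sweep 1 (reverse ms ∷ʳ m)
    ≡⟨ sweep-∷ʳ 1 (reverse ms) m ⟩
  sweep 1 (reverse ms) + (1 + m * arrivals 1 (reverse ms))
    ≡⟨ cong₂ (λ p r → p + (1 + m * r))
         (trans (sym (pathCount≡sweep (reverse ms))) (pathCount-reverse ms))
         (arrivals-reverse ms) ⟩
  pathCount ms + departures (m ∷ ms)
    ≡⟨ +-comm (pathCount ms) _ ⟩
  pathCount (m ∷ ms) ∎
  where open ≡-Reasoning

-- The number of paths of a trunk graph

finite-unique : ∀ {A} (x y : Finite A) → proj₁ x ≡ proj₁ y
finite-unique (_ , f) (_ , g) = ↔⇒≡ (↔-sym g ↔-∘ f)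

-- If the sizes of the fibres over the vertices satisfy the recursion of departures,
-- then the size of the total space satisfies that of pathCount.
finite-Σ-pathCount :
  ∀ {k} (ms : Vec ℕ k) {B : Fin (suc k) → Set} (f : ∀ i → Finite (B i)) →
  proj₁ (f (fromℕ k)) ≡ 1 →
  (∀ i → proj₁ (f (inject₁ i)) ≡ 1 + lookup ms i * proj₁ (f (suc i))) →
  proj₁ (f zero) ≡ departures (toList ms) ×
  proj₁ (finite-Σ f) ≡ pathCount (toList ms)
finite-Σ-pathCount Vec.[] f last step =
  last , trans (+-identityʳ _) last
finite-Σ-pathCount (m Vec.∷ ms) f last step = first , cong₂ _+_ first (proj₂ rest)
  where
  rest = finite-Σ-pathCount ms (λ i → f (suc i)) last (λ i → step (suc i))
  first = trans (step zero) (cong (λ r → 1 + m * r) (proj₁ rest))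

module _ {N : ℕ} (E : TrunkGraph N) where
  open TrunkGraph E

  P≡pathCount : P E ≡ pathCount (toList mult)
  P≡pathCount = proj₂ (finite-Σ-pathCount mult fin
    (finite-unique (fin (fromℕ (suc k))) last)
    (λ i → finite-unique (fin (inject₁ i)) (recurse i)))
    where
    fin : ∀ u → Finite (PathFrom E u)
    fin = pathFrom-finite E
    last : Finite (PathFrom E (fromℕ (suc k)))
    last = finite-↔ (unfold E _) (finite-⊎ finite-⊤
      (0 , mk↔ₛ′ (λ ()) (λ (_ , e , _) → ⊥-elim (last-none E e))
                 (λ (_ , e , _) → ⊥-elim (last-none E e)) (λ ())))
    recurse : ∀ i → Finite (PathFrom E (inject₁ i))
    recurse i = finite-↔ (unfold E _) (finite-⊎ finite-⊤
      (finite-↔ (step E i) (finite-× (_ , edges i) (fin (suc i)))))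

-- The trunk graph of a word

sum-toList : ∀ {n} (ms : Vec ℕ n) → Vec.sum ms ≡ sum (toList ms)
sum-toList Vec.[]       = refl
sum-toList (m Vec.∷ ms) = cong (m +_) (sum-toList ms)

-- An edge to suc i is a proof that it starts at inject₁ i, together with one of
-- the lookup mult i labels.
TrunkEdge : ∀ {n} → Vec ℕ n → Fin (suc n) → Fin (suc n) → Set
TrunkEdge mult u zero    = ⊥
TrunkEdge mult u (suc i) = u ≡ inject₁ i × Fin (lookup mult i)

trunk : ∀ m ms → All (1 ≤_) (m ∷ ms) → TrunkGraph (sum (m ∷ ms))
trunk m ms pos = record
  { k           = List.length ms
  ; Edge        = TrunkEdge mult
  ; consecutive = consecutive
  ; mult        = mult
  ; edges       = λ i → mk↔ₛ′ (λ j → refl , j) proj₂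
      (λ (eq , j) → cong (_, j) (Decidable⇒UIP.≡-irrelevant _≟ᶠ_ refl eq))
      (λ _ → refl)
  ; mult≥1      = VecAll.fromList⁺ pos
  ; total       = trans (sum-toList mult) (cong sum (toList∘fromList (m ∷ ms)))
  }
  where
  mult = fromList (m ∷ ms)
  consecutive : ∀ {u v} → TrunkEdge mult u v → toℕ v ≡ suc (toℕ u)
  consecutive {v = suc i} (refl , _) = cong suc (sym (toℕ-inject₁ i))

P-trunk : ∀ m ms pos → P (trunk m ms pos) ≡ pathCount (m ∷ ms)
P-trunk m ms pos = trans (P≡pathCount (trunk m ms pos))
                         (cong pathCount (toList∘fromList (m ∷ ms)))

-- The words 1 2ᵃ 3ᵇ 2ᶜ 1

word : ℕ → ℕ → ℕ → List ℕ
word a b c = 1 ∷ replicate a 2 ++ replicate b 3 ++ replicate c 2 ++ [ 1 ]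

sum-replicate-++ : ∀ n x ys → sum (replicate n x ++ ys) ≡ n * x + sum ys
sum-replicate-++ zero    x ys = refl
sum-replicate-++ (suc n) x ys =
  trans (cong (x +_) (sum-replicate-++ n x ys)) (sym (+-assoc x _ _))

sum-word : ∀ a b c → sum (word a b c) ≡ 2 + (a * 2 + b * 3 + c * 2)
sum-word a b c
  rewrite sum-replicate-++ a 2 (replicate b 3 ++ replicate c 2 ++ [ 1 ])
        | sum-replicate-++ b 3 (replicate c 2 ++ [ 1 ])
        | sum-replicate-++ c 2 [ 1 ] = regroup (a * 2) (b * 3) (c * 2)
  where
  regroup : ∀ x y z → 1 + (x + (y + (z + 1))) ≡ 2 + (x + y + z)
  regroup = solve-∀

word-letters : ∀ {p} {Q : ℕ → Set p} a b c → Q 1 → Q 2 → Q 3 → All Q (word a b c)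
word-letters a b c q₁ q₂ q₃ =
  q₁ ∷ ++⁺ (replicate⁺ a q₂) (++⁺ (replicate⁺ b q₃) (++⁺ (replicate⁺ c q₂) (q₁ ∷ [])))

reverse-replicate : ∀ {A : Set} n (x : A) → reverse (replicate n x) ≡ replicate n x
reverse-replicate zero    x = refl
reverse-replicate (suc n) x =
  trans (unfold-reverse x (replicate n x))
        (trans (cong (_∷ʳ x) (reverse-replicate n x)) (replicate-∷ʳ n))
  where
  replicate-∷ʳ : ∀ n → replicate n x ∷ʳ x ≡ x ∷ replicate n x
  replicate-∷ʳ zero    = refl
  replicate-∷ʳ (suc n) = cong (x ∷_) (replicate-∷ʳ n)

reverse-word : ∀ a b c → reverse (word a b c) ≡ word c b a
reverse-word a b c
  rewrite unfold-reverse 1 (replicate a 2 ++ replicate b 3 ++ replicate c 2 ++ [ 1 ])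
        | reverse-++ (replicate a 2) (replicate b 3 ++ replicate c 2 ++ [ 1 ])
        | reverse-++ (replicate b 3) (replicate c 2 ++ [ 1 ])
        | reverse-++ (replicate c 2) [ 1 ]
        | reverse-replicate a 2 | reverse-replicate b 3 | reverse-replicate c 2
        | ++-assoc (replicate c 2 ++ replicate b 3) (replicate a 2) [ 1 ]
        | ++-assoc (replicate c 2) (replicate b 3) (replicate a 2 ++ [ 1 ])
  = refl

pathCount-word-sym : ∀ a b c → pathCount (word a b c) ≡ pathCount (word c b a)
pathCount-word-sym a b c =
  trans (sym (pathCount-reverse (word a b c))) (cong pathCount (reverse-word a b c))

-- Another word of the same form and the same sum has more paths.
Improvable : ℕ → ℕ → ℕ → Set
Improvable a b c = ∃ λ a′ → ∃ λ b′ → ∃ λ c′ →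
  a′ * 2 + b′ * 3 + c′ * 2 ≡ a * 2 + b * 3 + c * 2 ×
  pathCount (word a b c) < pathCount (word a′ b′ c′)

improvable-sym : ∀ a b c → Improvable c b a → Improvable a b c
improvable-sym a b c (a′ , b′ , c′ , eq , lt) =
  a′ , b′ , c′ , trans eq (swap (c * 2) (b * 3) (a * 2)) ,
  subst (_< pathCount (word a′ b′ c′)) (pathCount-word-sym c b a) lt
  where
  swap : ∀ x y z → x + y + z ≡ z + y + x
  swap = solve-∀

gain⇒< : ∀ {m n} d → m + suc d ≡ n → m < n
gain⇒< {m} d refl = m<m+n m (s≤s z≤n)

-- Replacing 2 2 2 by 3 3

exchange : ∀ l ys → 5 ≤ l → 10 ≤ departures ys →
  sweep l (2 ∷ 2 ∷ 2 ∷ ys) < sweep l (3 ∷ 3 ∷ ys)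
exchange l ys 5≤l 10≤r with m≤n⇒∃[o]m+o≡n 5≤l | m≤n⇒∃[o]m+o≡n 10≤r
... | x , 5+x≡l | y , 10+y≡r = gain⇒< (1 + 7 * x + 2 * y + x * y) (begin
  l + (l₁ + (l₂ + sweep (1 + 2 * l₂) ys)) + d
    ≡⟨ cong (λ t → l + (l₁ + (l₂ + t)) + d) (sweep-suc (2 * l₂) ys) ⟩
  l + (l₁ + (l₂ + (p + 2 * l₂ * departures ys))) + d
    ≡⟨ gain (sym 5+x≡l) (sym 10+y≡r) p ⟩
  l + (l₃ + (p + 3 * l₃ * departures ys))
    ≡⟨ cong (λ t → l + (l₃ + t)) (sweep-suc (3 * l₃) ys) ⟨
  l + (l₃ + sweep (1 + 3 * l₃) ys) ∎)
  where
  open ≡-Reasoning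
  l₁ = 1 + 2 * l
  l₂ = 1 + 2 * l₁
  l₃ = 1 + 3 * l
  d  = 2 + 7 * x + 2 * y + x * y
  p  = pathCount ys
  -- The gain (l - 3) * (r - 3) - 12 for l = 5 + x and r = 10 + y.
  expand : ∀ x y p →
    (5 + x) + ((1 + 2 * (5 + x)) + ((1 + 2 * (1 + 2 * (5 + x))) +
      (p + 2 * (1 + 2 * (1 + 2 * (5 + x))) * (10 + y))))
      + (2 + 7 * x + 2 * y + x * y)
    ≡ (5 + x) + ((1 + 3 * (5 + x)) + (p + 3 * (1 + 3 * (5 + x)) * (10 + y)))
  expand = solve-∀
  gain : ∀ {l x r y} → l ≡ 5 + x → r ≡ 10 + y → ∀ p →
    l + ((1 + 2 * l) + ((1 + 2 * (1 + 2 * l)) +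
      (p + 2 * (1 + 2 * (1 + 2 * l)) * r))) + (2 + 7 * x + 2 * y + x * y)
    ≡ l + ((1 + 3 * l) + (p + 3 * (1 + 3 * l) * r))
  gain {x = x} {y = y} refl refl = expand x y

exchange-after-twos : ∀ k l ys → 5 ≤ l → 10 ≤ departures ys →
  sweep l (replicate (3 + k) 2 ++ ys) < sweep l (replicate k 2 ++ 3 ∷ 3 ∷ ys)
exchange-after-twos zero    l ys 5≤l 10≤r = exchange l ys 5≤l 10≤r
exchange-after-twos (suc k) l ys 5≤l 10≤r = +-monoʳ-< l
  (exchange-after-twos k (1 + 2 * l) ys
    (≤-trans 5≤l (≤-trans (m≤m+n l (1 * l)) (n≤1+n _))) 10≤r)

improve-long : ∀ k b c → Improvable (4 + k) (2 + b) c
improve-long k b c = 1 + k , 4 + b , c , size k b c ,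
  subst₂ _<_ (sym (pathCount≡sweep (word (4 + k) (2 + b) c)))
             (sym (pathCount≡sweep (word (1 + k) (4 + b) c)))
    -- After 1 2 the sweep has reached 1 + 2 * (1 + 1 * 1) = 5.
    (+-monoʳ-< 3 (exchange-after-twos k 5 (3 ∷ 3 ∷ ys) ≤-refl 10≤r))
  where
  ys = replicate b 3 ++ replicate c 2 ++ [ 1 ]
  departures≥1 : ∀ ms → 1 ≤ departures ms
  departures≥1 []       = ≤-refl
  departures≥1 (m ∷ ms) = s≤s z≤n
  10≤r : 10 ≤ departures (3 ∷ 3 ∷ ys)
  10≤r = ≤-trans (m≤m+n 10 3)
    (+-monoʳ-≤ 1 (*-monoʳ-≤ 3 (+-monoʳ-≤ 1 (*-monoʳ-≤ 3 (departures≥1 ys)))))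
  size : ∀ k b c →
    (1 + k) * 2 + (4 + b) * 3 + c * 2 ≡ (4 + k) * 2 + (2 + b) * 3 + c * 2
  size = solve-∀

-- A run of 3s between a short prefix and a short suffix

-- The number 3ⁿ⁻¹ + ⋯ + 3 + 1 = (3ⁿ - 1) / 2 of paths that end at the last vertex
-- of the word 3ⁿ⁻¹; it is 0 for n = 0.
repunit : ℕ → ℕ
repunit zero    = 0
repunit (suc n) = 1 + 3 * repunit n

-- The sum of repunit i for 1 ≤ i ≤ n; for n ≥ 1 this is the number of all paths
-- of the word 3ⁿ⁻¹.
repunitSum : ℕ → ℕ
repunitSum zero    = 0
repunitSum (suc n) = repunitSum n + repunit (suc n)

departures-threes : ∀ b ys → departures (replicate b 3 ++ ys) ≡
  repunit b + (1 + 2 * repunit b) * departures ys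
departures-threes zero    ys = sym (+-identityʳ _)
departures-threes (suc b) ys =
  trans (cong (λ r → 1 + 3 * r) (departures-threes b ys))
        (regroup (repunit b) (departures ys))
  where
  regroup : ∀ s r →
    1 + 3 * (s + (1 + 2 * s) * r) ≡ (1 + 3 * s) + (1 + 2 * (1 + 3 * s)) * r
  regroup = solve-∀

pathCount-threes : ∀ b ys → pathCount (replicate b 3 ++ ys) ≡
  pathCount ys + repunitSum b + 3 * repunit b * departures ys
pathCount-threes zero    ys =
  sym (trans (+-identityʳ _) (+-identityʳ _))
pathCount-threes (suc b) ys =
  trans (cong₂ _+_ (departures-threes (suc b) ys) (pathCount-threes b ys))
        (regroup (repunit b) (repunitSum b) (departures ys) (pathCount ys))
  where
  regroup : ∀ s q r p →
    (1 + 3 * s + (1 + 2 * (1 + 3 * s)) * r) + (p + q + 3 * s * r)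
    ≡ p + (q + (1 + 3 * s)) + 3 * (1 + 3 * s) * r
  regroup = solve-∀

sweep-threes : ∀ x b ys → sweep (1 + x) (replicate b 3 ++ ys) ≡
  (pathCount ys + repunitSum b + 3 * repunit b * departures ys) +
  x * (repunit b + (1 + 2 * repunit b) * departures ys)
sweep-threes x b ys = trans (sweep-suc x (replicate b 3 ++ ys))
  (cong₂ (λ p r → p + x * r) (pathCount-threes b ys) (departures-threes b ys))

-- The part of a word after its 3s.
suffix : ℕ → List ℕ
suffix c = replicate c 2 ++ [ 1 ]

-- In the prefix 1 2ᵃ, k paths end before the last vertex and 1 + x paths end at
-- it.  The numbers p , r , s , q are arguments so that they can be literals or
-- expanded repunits in the result.
pathCount-word : ∀ a k x →
  (∀ ms → sweep 1 (1 ∷ replicate a 2 ++ ms) ≡ k + sweep (1 + x) ms) →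
  ∀ b c {p r s q} → pathCount (suffix c) ≡ p → departures (suffix c) ≡ r →
  repunit b ≡ s → repunitSum b ≡ q →
  pathCount (word a b c) ≡ k + (((p + q) + 3 * s * r) + x * (s + (1 + 2 * s) * r))
pathCount-word a k x prefix b c refl refl refl refl = trans
  (pathCount≡sweep (word a b c))
  (trans (prefix (replicate b 3 ++ suffix c)) (cong (k +_) (sweep-threes x b (suffix c))))

-- The words 1 2 2 2 3ᵇ 2ᶜ 1 with few 2s on the right

-- In each case u and v are repunit and repunitSum at 2 + b, expanded in terms of
-- their values s and q at b, and w and z are those at 4 + b.  The number q cancels
-- in the gain.  The expansion is needed if c = 2: there the gain is 4 * u - 8,
-- which is positive only for u > 2, hence not for fewer than two 3s.
improve-short : ∀ b c → c ≤ 3 → Improvable 3 (2 + b) c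
improve-short b 0 _ = 2 , 2 + b , 1 , size b , gain⇒< (35 + 81 * s)
  (trans (cong (_+ (36 + 81 * s)) before) (trans (gain s q) (sym after)))
  where
  s = repunit b
  q = repunitSum b
  size : ∀ b → 2 * 2 + (2 + b) * 3 + 1 * 2 ≡ 3 * 2 + (2 + b) * 3 + 0 * 2
  size = solve-∀
  before :
    let u = 1 + 3 * (1 + 3 * s) ; v = q + (1 + 3 * s) + u
    in pathCount (word 3 (2 + b) 0) ≡
       19 + (((3 + v) + 3 * u * 2) + 22 * (u + (1 + 2 * u) * 2))
  before = pathCount-word 3 19 22 (λ _ → refl) (2 + b) 0 refl refl refl refl
  after :
    let u = 1 + 3 * (1 + 3 * s) ; v = q + (1 + 3 * s) + u
    in pathCount (word 2 (2 + b) 1) ≡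
       8 + (((8 + v) + 3 * u * 5) + 10 * (u + (1 + 2 * u) * 5))
  after = pathCount-word 2 8 10 (λ _ → refl) (2 + b) 1 refl refl refl refl
  gain : ∀ s q →
    let u = 1 + 3 * (1 + 3 * s) ; v = q + (1 + 3 * s) + u
    in 19 + (((3 + v) + 3 * u * 2) + 22 * (u + (1 + 2 * u) * 2))
         + (36 + 81 * s)
       ≡ 8 + (((8 + v) + 3 * u * 5) + 10 * (u + (1 + 2 * u) * 5))
  gain = solve-∀
improve-short b 1 _ = 2 , 2 + b , 2 , size b , gain⇒< (23 + 54 * s)
  (trans (cong (_+ (24 + 54 * s)) before) (trans (gain s q) (sym after)))
  where
  s = repunit b
  q = repunitSum b
  size : ∀ b → 2 * 2 + (2 + b) * 3 + 2 * 2 ≡ 3 * 2 + (2 + b) * 3 + 1 * 2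
  size = solve-∀
  before :
    let u = 1 + 3 * (1 + 3 * s) ; v = q + (1 + 3 * s) + u
    in pathCount (word 3 (2 + b) 1) ≡
       19 + (((8 + v) + 3 * u * 5) + 22 * (u + (1 + 2 * u) * 5))
  before = pathCount-word 3 19 22 (λ _ → refl) (2 + b) 1 refl refl refl refl
  after :
    let u = 1 + 3 * (1 + 3 * s) ; v = q + (1 + 3 * s) + u
    in pathCount (word 2 (2 + b) 2) ≡
       8 + (((19 + v) + 3 * u * 11) + 10 * (u + (1 + 2 * u) * 11))
  after = pathCount-word 2 8 10 (λ _ → refl) (2 + b) 2 refl refl refl refl
  gain : ∀ s q →
    let u = 1 + 3 * (1 + 3 * s) ; v = q + (1 + 3 * s) + u
    in 19 + (((8 + v) + 3 * u * 5) + 22 * (u + (1 + 2 * u) * 5))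
         + (24 + 54 * s)
       ≡ 8 + (((19 + v) + 3 * u * 11) + 10 * (u + (1 + 2 * u) * 11))
  gain = solve-∀
improve-short b 2 _ = 1 , 4 + b , 1 , size b , gain⇒< (7 + 36 * s)
  (trans (cong (_+ (8 + 36 * s)) before) (trans (gain s q) (sym after)))
  where
  s = repunit b
  q = repunitSum b
  size : ∀ b → 1 * 2 + (4 + b) * 3 + 1 * 2 ≡ 3 * 2 + (2 + b) * 3 + 2 * 2
  size = solve-∀
  before :
    let u = 1 + 3 * (1 + 3 * s) ; v = q + (1 + 3 * s) + u
        w = 1 + 3 * (1 + 3 * u) ; z = v + (1 + 3 * u) + w
    in pathCount (word 3 (2 + b) 2) ≡
       19 + (((19 + v) + 3 * u * 11) + 22 * (u + (1 + 2 * u) * 11))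
  before = pathCount-word 3 19 22 (λ _ → refl) (2 + b) 2 refl refl refl refl
  after :
    let u = 1 + 3 * (1 + 3 * s) ; v = q + (1 + 3 * s) + u
        w = 1 + 3 * (1 + 3 * u) ; z = v + (1 + 3 * u) + w
    in pathCount (word 1 (4 + b) 1) ≡
       3 + (((8 + z) + 3 * w * 5) + 4 * (w + (1 + 2 * w) * 5))
  after = pathCount-word 1 3 4 (λ _ → refl) (4 + b) 1 refl refl refl refl
  gain : ∀ s q →
    let u = 1 + 3 * (1 + 3 * s) ; v = q + (1 + 3 * s) + u
        w = 1 + 3 * (1 + 3 * u) ; z = v + (1 + 3 * u) + w
    in 19 + (((19 + v) + 3 * u * 11) + 22 * (u + (1 + 2 * u) * 11))
         + (8 + 36 * s)
       ≡ 3 + (((8 + z) + 3 * w * 5) + 4 * (w + (1 + 2 * w) * 5))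
  gain = solve-∀
improve-short b 3 _ = 1 , 4 + b , 2 , size b , gain⇒< (139 + 306 * s)
  (trans (cong (_+ (140 + 306 * s)) before) (trans (gain s q) (sym after)))
  where
  s = repunit b
  q = repunitSum b
  size : ∀ b → 1 * 2 + (4 + b) * 3 + 2 * 2 ≡ 3 * 2 + (2 + b) * 3 + 3 * 2
  size = solve-∀
  before :
    let u = 1 + 3 * (1 + 3 * s) ; v = q + (1 + 3 * s) + u
        w = 1 + 3 * (1 + 3 * u) ; z = v + (1 + 3 * u) + w
    in pathCount (word 3 (2 + b) 3) ≡
       19 + (((42 + v) + 3 * u * 23) + 22 * (u + (1 + 2 * u) * 23))
  before = pathCount-word 3 19 22 (λ _ → refl) (2 + b) 3 refl refl refl refl
  after :
    let u = 1 + 3 * (1 + 3 * s) ; v = q + (1 + 3 * s) + u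
        w = 1 + 3 * (1 + 3 * u) ; z = v + (1 + 3 * u) + w
    in pathCount (word 1 (4 + b) 2) ≡
       3 + (((19 + z) + 3 * w * 11) + 4 * (w + (1 + 2 * w) * 11))
  after = pathCount-word 1 3 4 (λ _ → refl) (4 + b) 2 refl refl refl refl
  gain : ∀ s q →
    let u = 1 + 3 * (1 + 3 * s) ; v = q + (1 + 3 * s) + u
        w = 1 + 3 * (1 + 3 * u) ; z = v + (1 + 3 * u) + w
    in 19 + (((42 + v) + 3 * u * 23) + 22 * (u + (1 + 2 * u) * 23))
         + (140 + 306 * s)
       ≡ 3 + (((19 + z) + 3 * w * 11) + 4 * (w + (1 + 2 * w) * 11))
  gain = solve-∀
improve-short b (suc (suc (suc (suc _)))) (s≤s (s≤s (s≤s ())))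

-- Maximality

improvable : ∀ a b c → 3 ≤ a → 2 ≤ b → Improvable a b c
improvable a b c 3≤a 2≤b with m≤n⇒∃[o]m+o≡n 3≤a | m≤n⇒∃[o]m+o≡n 2≤b
... | suc k , refl | b′ , refl = improve-long k b′ c
... | zero  , refl | b′ , refl with ≤-<-connex c 3
...   | inj₁ c≤3 = improve-short b′ c c≤3
...   | inj₂ 3<c with m≤n⇒∃[o]m+o≡n 3<c
...     | k , refl = improvable-sym 3 (2 + b′) (4 + k) (improve-long k b′ 3)

not-improvable : ∀ {N} (F : TrunkGraph N) → IsSupremum (PathCounts N) (P F) →
  ∀ a b c → HasSequence F 1 a b c 1 → ¬ Improvable a b c
not-improvable {N} F (upper , _) a b c seq (a′ , b′ , c′ , size , lt) =
  <⇒≱ lt (subst₂ _≤_ (P-trunk _ _ pos)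
                      (trans (P≡pathCount F) (cong pathCount seq))
                      (upper _ better))
  where
  open TrunkGraph F using (mult; total)
  pos : All (1 ≤_) (word a′ b′ c′)
  pos = word-letters a′ b′ c′ (s≤s z≤n) (s≤s z≤n) (s≤s z≤n)
  G : TrunkGraph (sum (word a′ b′ c′))
  G = trunk _ _ pos
  G∈T₃ : InT₃ G
  G∈T₃ = VecAll.fromList⁺
    (word-letters a′ b′ c′ (s≤s z≤n) (s≤s (s≤s z≤n)) (s≤s (s≤s (s≤s z≤n))))
  sum≡N : sum (word a′ b′ c′) ≡ N
  sum≡N = begin
    sum (word a′ b′ c′)             ≡⟨ sum-word a′ b′ c′ ⟩
    2 + (a′ * 2 + b′ * 3 + c′ * 2)  ≡⟨ cong (2 +_) size ⟩
    2 + (a * 2 + b * 3 + c * 2)     ≡⟨ sum-word a b c ⟨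
    sum (word a b c)                ≡⟨ cong sum seq ⟨
    sum (toList mult)               ≡⟨ sum-toList mult ⟨
    Vec.sum mult                    ≡⟨ total ⟩
    N                               ∎
    where open ≡-Reasoning
  better : PathCounts N (P G)
  better = subst (λ n → PathCounts n (P G)) sum≡N (G , G∈T₃ , refl)

theorem3p13 : ∀ (N : ℕ) → 0 < N →
    (F : TrunkGraph N) → InT₃ F →
    IsSupremum (PathCounts N) (P F) →
    ∀ (n₂ n₃ n₄ : ℕ) → HasSequence F 1 n₂ n₃ n₄ 1 → 1 < n₃ →
    n₂ ⊔ n₄ ≤ 2
theorem3p13 N _ F _ isSup n₂ n₃ n₄ seq 1<n₃ = ⊔-lub
  (≮⇒≥ λ 2<n₂ → not-improvable F isSup n₂ n₃ n₄ seq
    (improvable n₂ n₃ n₄ 2<n₂ 1<n₃))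
  (≮⇒≥ λ 2<n₄ → not-improvable F isSup n₂ n₃ n₄ seq
    (improvable-sym n₂ n₃ n₄ (improvable n₄ n₃ n₂ 2<n₄ 1<n₃)))
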